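{- There exists a graph $G$ whose girth is equal to $5$ that does not have the AOP property.
   Context: All graphs are finite, simple and undirected. The girth of a graph is the length of a shortest cycle in it. An orientation of $G$ assigns exactly one direction to each edge; it is acyclic if it has no directed cycle. A graph $G$ has the AOP (acyclic one path) property if it has an acyclic orientation such that there is at most one directed path between any two vertices, i.e. for all distinct vertices $u,v$ there is at most one directed path from $u$ to $v$. -}

module Defs where

open import Data.Empty using (⊥)
open import Data.Fin.Base using (Fin)
open import Data.List.Base using (List; _∷_; []; _∷ʳ_; length; head; last)
open import Data.List.Relation.Unary.Linked using (Linked)
open import Data.List.Relation.Unary.Unique.Propositional using (Unique)
open import Data.Maybe.Base using (just)
open import Data.Nat.Base using (ℕ; _≤_)
open import Data.Product.Base using (∃-syntax; _×_)
open import Data.Sum.Base using (_⊎_)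
open import Level using (0ℓ)
open import Relation.Binary.Core using (Rel; _⇒_)
open import Relation.Binary.Definitions
  using (Symmetric; Asymmetric; Irreflexive; Decidable)
open import Relation.Binary.PropositionalEquality.Core using (_≡_; _≢_)
open import Relation.Nullary.Negation.Core using (¬_)

record Graph : Set₁ where
  field
    order  : ℕ
    Adj    : Rel (Fin order) 0ℓ
    symm   : Symmetric Adj
    irrefl : Irreflexive _≡_ Adj
    adj?   : Decidable Adj

  Vertex : Set
  Vertex = Fin order

module _ {V : Set} (R : Rel V 0ℓ) where

  -- The vertices of a cycle are listed once each; the step from the last
  -- vertex back to the first is part of the linkage condition.
  IsDirectedCycle : List V → Set
  IsDirectedCycle []       = ⊥
  IsDirectedCycle (v ∷ vs) = Unique (v ∷ vs) × Linked R (v ∷ (vs ∷ʳ v))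

  record IsDirectedPath (u v : V) (vs : List V) : Set where
    field
      starts   : head vs ≡ just u
      ends     : last vs ≡ just v
      distinct : Unique vs
      linked   : Linked R vs

module _ (G : Graph) where
  open Graph G

  -- The length bound excludes going back and forth along a single edge.
  IsCycle : List Vertex → Set
  IsCycle vs = 3 ≤ length vs × IsDirectedCycle Adj vs

  HasGirth : ℕ → Set
  HasGirth g = (∃[ vs ] IsCycle vs × length vs ≡ g)
             × (∀ vs → IsCycle vs → g ≤ length vs)

  record Orientation : Set₁ where
    field
      Arc      : Rel Vertex 0ℓ
      arc⇒adj  : Arc ⇒ Adj
      directed : ∀ {u v} → Adj u v → Arc u v ⊎ Arc v u
      asym     : Asymmetric Arc

  module _ (O : Orientation) where
    open Orientation O

    Acyclic : Set
    Acyclic = ∀ vs → ¬ IsDirectedCycle Arc vs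

    -- A path is identified with its sequence of vertices, so that different
    -- proofs of the same arc do not count as different paths.
    AtMostOnePath : Set
    AtMostOnePath = ∀ u v → u ≢ v → ∀ ps qs →
      IsDirectedPath Arc u v ps → IsDirectedPath Arc u v qs → ps ≡ qs

  HasAOP : Set₁
  HasAOP = ∃[ O ] Acyclic O × AtMostOnePath O

{-# OPTIONS --safe #-}
module Submission where

-- The Hoffman–Singleton graph has girth 5 and diameter 2.  In an acyclic
-- orientation of a graph of diameter 2 with unique paths, no directed path
-- u → a → b → v exists: u and v are adjacent or have a common neighbour w, and
-- every way of orienting the edges that join them closes a directed cycle or
-- yields a second path.  Hence two vertices that are neither source nor sink
-- are never adjacent, so sources, sinks and the remaining vertices form a
-- proper 3-colouring; but the Hoffman–Singleton graph is not 3-colourable.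

open import Defs
open import Data.Bool.Base using (Bool; false; _∧_; _∨_; T)
open import Data.Bool.Properties using (∨-comm; T?)
open import Data.Empty using (⊥; ⊥-elim)
open import Data.Fin.Base using (Fin; toℕ)
open import Data.Fin.Patterns using (0F; 1F; 2F; 3F; 4F)
open import Data.Fin.Properties using (_≟_; all?; any?)
open import Data.List.Base using (List; []; _∷_; _++_; _∷ʳ_; head; last; length; allFin)
open import Data.List.Membership.Propositional using (_∉_)
open import Data.List.Membership.Propositional.Properties using (∈-∃++)
open import Data.List.Relation.Unary.All as All using (All; []; _∷_)
open import Data.List.Relation.Unary.All.Properties using (¬Any⇒All¬)
  renaming (++⁻ to all-++⁻)
open import Data.List.Relation.Unary.AllPairs using ([]; _∷_)
open import Data.List.Relation.Unary.Any as Any using (Any)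
open import Data.List.Relation.Unary.Linked using (Linked; []; [-]; _∷_; linked?)
open import Data.List.Relation.Unary.Unique.Propositional using (Unique)
open import Data.List.Relation.Unary.Unique.DecPropositional using (unique?)
open import Data.Maybe.Base using (just)
open import Data.Nat.Base using (ℕ; _+_; _*_; _/_; _%_; _≡ᵇ_; _≤_; s≤s; z≤n)
open import Data.Product.Base using (∃-syntax; _×_; _,_)
open import Data.Sum.Base using (_⊎_; inj₁; inj₂)
open import Level using (0ℓ)
open import Relation.Binary.Core using (Rel)
open import Relation.Binary.Definitions using (Decidable)
open import Relation.Binary.PropositionalEquality
  using (_≡_; _≢_; refl; sym; trans; subst; ≢-sym)
open import Relation.Nullary.Decidable
  using (Dec; yes; no; ¬?; _×-dec_; _→-dec_; _⊎-dec_; from-yes)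
open import Relation.Nullary.Negation.Core using (¬_)

unique-++⁻ : ∀ {V : Set} (xs : List V) {y zs} →
  Unique (xs ++ y ∷ zs) → Unique (y ∷ xs)
unique-++⁻ []       _          = [] ∷ []
unique-++⁻ (x ∷ xs) (x∉ ∷ xs!) with unique-++⁻ xs xs! | all-++⁻ xs x∉
... | y∉xs ∷ xs!′ | x∉xs , x≢y ∷ _ = (≢-sym x≢y ∷ y∉xs) ∷ x∉xs ∷ xs!′

module _ {V : Set} {R : Rel V 0ℓ} where

  linked-++⁻ : ∀ xs {y zs} → Linked R (xs ++ y ∷ zs) → Linked R (xs ∷ʳ y)
  linked-++⁻ []            _        = [-]
  linked-++⁻ (_ ∷ [])      (r ∷ _)  = r ∷ [-]
  linked-++⁻ (_ ∷ x ∷ xs)  (r ∷ rs) = r ∷ linked-++⁻ (x ∷ xs) rs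

  module _ (acyclic : ∀ vs → ¬ IsDirectedCycle R vs) where

    -- If `x` recurs in the tail, the stretch from `x` to that recurrence closes up. By induction
    -- the tail repeats nothing, so this is a directed cycle.
    linked⇒unique : ∀ {vs} → Linked R vs → Unique vs
    linked⇒unique []  = []
    linked⇒unique [-] = [] ∷ []
    linked⇒unique {x ∷ y ∷ ys} (r ∷ rs) = ¬Any⇒All¬ _ x∉ ∷ ys!
      where
      ys! : Unique (y ∷ ys)
      ys! = linked⇒unique rs

      x∉ : x ∉ y ∷ ys
      x∉ x∈ with ∈-∃++ x∈
      ... | ps , qs , eq =
        acyclic (x ∷ ps)
          ( unique-++⁻ ps (subst Unique eq ys!)
          , linked-++⁻ (x ∷ ps) (subst (λ zs → Linked R (x ∷ zs)) eq (r ∷ rs)) )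

module _ (G : Graph) where
  open Graph G

  HasDiameter≤2 : Set
  HasDiameter≤2 = ∀ u v → u ≡ v ⊎ Adj u v ⊎ ∃[ w ] Adj u w × Adj w v

  ProperColouring : ∀ {k} → (Vertex → Fin k) → Set
  ProperColouring c = ∀ {u v} → Adj u v → c u ≢ c v

  module _ (diameter≤2 : HasDiameter≤2) (O : Orientation G)
           (acyclic : Acyclic G O) (unipath : AtMostOnePath G O) where
    open Orientation O

    unrepeated : ∀ {vs} → Linked Arc vs → Unique vs
    unrepeated = linked⇒unique acyclic

    walks-agree : ∀ {u v ps qs} → u ≢ v →
      head ps ≡ just u → last ps ≡ just v → Linked Arc ps →
      head qs ≡ just u → last qs ≡ just v → Linked Arc qs → ps ≡ qs
    walks-agree u≢v hp lp ps hq lq qs = unipath _ _ u≢v _ _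
      record { starts = hp ; ends = lp ; distinct = unrepeated ps ; linked = ps }
      record { starts = hq ; ends = lq ; distinct = unrepeated qs ; linked = qs }

    no-walk-with-3-arcs : ∀ {u a b v} → Arc u a → Arc a b → ¬ Arc b v
    no-walk-with-3-arcs {u} {a} {b} {v} ua ab bv with unrepeated (ua ∷ ab ∷ bv ∷ [-])
    ... | (_ ∷ _ ∷ u≢v ∷ []) ∷ _ = close (diameter≤2 u v)
      where
      close₂ : ∀ {w} → Arc u w ⊎ Arc w u → Arc w v ⊎ Arc v w → ⊥
      -- The first three cases compare walks of different lengths: 3 arcs against 2, then twice 4
      -- against 1. The last case is a closed walk of 5 arcs.
      close₂ (inj₁ uw) (inj₁ wv) with walks-agree u≢v
        refl refl (ua ∷ ab ∷ bv ∷ [-]) refl refl (uw ∷ wv ∷ [-])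
      ... | ()
      close₂ (inj₁ uw) (inj₂ vw) with unrepeated (uw ∷ [-])
      ... | (u≢w ∷ []) ∷ _ with walks-agree u≢w
        refl refl (ua ∷ ab ∷ bv ∷ vw ∷ [-]) refl refl (uw ∷ [-])
      ... | ()
      close₂ (inj₂ wu) (inj₁ wv) with unrepeated (wv ∷ [-])
      ... | (w≢v ∷ []) ∷ _ with walks-agree w≢v
        refl refl (wu ∷ ua ∷ ab ∷ bv ∷ [-]) refl refl (wv ∷ [-])
      ... | ()
      close₂ (inj₂ wu) (inj₂ vw) with unrepeated (ua ∷ ab ∷ bv ∷ vw ∷ wu ∷ [-])
      ... | (_ ∷ _ ∷ _ ∷ _ ∷ u≢u ∷ []) ∷ _ = u≢u refl

      close : u ≡ v ⊎ Adj u v ⊎ ∃[ w ] Adj u w × Adj w v → ⊥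
      close (inj₁ u≡v) = u≢v u≡v
      close (inj₂ (inj₁ uv)) with directed uv
      ... | inj₁ u→v with walks-agree u≢v
        refl refl (ua ∷ ab ∷ bv ∷ [-]) refl refl (u→v ∷ [-])
      ...   | ()
      close (inj₂ (inj₁ uv)) | inj₂ v→u with unrepeated (ua ∷ ab ∷ bv ∷ v→u ∷ [-])
      ... | (_ ∷ _ ∷ _ ∷ u≢u ∷ []) ∷ _ = u≢u refl
      close (inj₂ (inj₂ (w , uw , wv))) = close₂ (directed uw) (directed wv)

    arc? : Decidable Arc
    arc? u v with adj? u v
    ... | no ¬uv = no λ uv → ¬uv (arc⇒adj uv)
    ... | yes uv with directed uv
    ...   | inj₁ u→v = yes u→v
    ...   | inj₂ v→u = no (asym v→u)

    -- 0F for sources, 1F for through vertices, 2F for sinks;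
    -- isolated vertices count as sources.
    colour : Vertex → Fin 3
    colour v with any? (λ u → arc? u v) | any? (λ w → arc? v w)
    ... | no _  | _     = 0F
    ... | yes _ | yes _ = 1F
    ... | yes _ | no _  = 2F

    -- The arc itself rules out that `u` is a sink or `v` a source. Equal colours thus leave only
    -- two through vertices, and extending the arc at both ends gives three consecutive arcs.
    arc⇒colour≢ : ∀ {u v} → Arc u v → colour u ≢ colour v
    arc⇒colour≢ {u} {v} uv
      with any? (λ t → arc? t u) | any? (λ w → arc? u w)
         | any? (λ t → arc? t v) | any? (λ w → arc? v w)
    ... | _            | no ¬u→ | _      | _            = λ _ → ¬u→ (v , uv)
    ... | _            | _      | no ¬→v | _            = λ _ → ¬→v (u , uv)
    ... | no _         | yes _  | yes _  | yes _        = λ ()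
    ... | no _         | yes _  | yes _  | no _         = λ ()
    ... | yes _        | yes _  | yes _  | no _         = λ ()
    ... | yes (_ , tu) | yes _  | yes _  | yes (_ , vw) = λ _ → no-walk-with-3-arcs tu uv vw

    colour-proper : ProperColouring colour
    colour-proper uv with directed uv
    ... | inj₁ u→v = arc⇒colour≢ u→v
    ... | inj₂ v→u = ≢-sym (arc⇒colour≢ v→u)

  -- Refuted k as vs is a search tree showing that the partial k-colouring as
  -- has no proper extension to the vertices vs, coloured in this order.
  Refuted : ∀ k → List (Vertex × Fin k) → List Vertex → Set
  Refuted k as []       = ⊥
  Refuted k as (v ∷ vs) = ∀ c →
    Any (λ (w , d) → c ≡ d × Adj v w) as ⊎ Refuted k ((v , c) ∷ as) vs

  refuted? : ∀ k as vs → Dec (Refuted k as vs)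
  refuted? k as []       = no λ ()
  refuted? k as (v ∷ vs) = all? λ c →
    -- Testing for a clash first cuts off the search below a clashing colour.
    Any.any? (λ (w , d) → (c ≟ d) ×-dec adj? v w) as ⊎-dec
    refuted? k ((v , c) ∷ as) vs

  -- A proper `f` selects the branch `c = f v` at every node. No clash can end that branch, so it
  -- runs down to `⊥`.
  refuted⇒¬proper : ∀ {k} {f : Vertex → Fin k} → ProperColouring f →
    ∀ {as} vs → All (λ (w , d) → f w ≡ d) as → ¬ Refuted k as vs
  refuted⇒¬proper proper []       agrees ()
  refuted⇒¬proper {f = f} proper (v ∷ vs) agrees r with r (f v)
  ... | inj₂ r′ = refuted⇒¬proper proper vs (refl ∷ agrees) r′
  ... | inj₁ clash with All.lookupAny agrees clash
  ...   | fw≡d , fv≡d , vw = proper vw (trans fv≡d (sym fw≡d))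

-- Vertex 10i + 5s + j is vertex j of pentagon i if s = 0, and of pentagram i if s = 1.
pentagon kind position : Fin 50 → ℕ
pentagon v = toℕ v / 10
kind     v = toℕ v / 5 % 2
position v = toℕ v % 5

-- Robertson's construction: five pentagons (kind 0), five pentagrams (kind 1),
-- and vertex j of pentagon h joined to vertex h·i + j of pentagram i.
-- Numbering pentagons and pentagrams alternately makes the search for a
-- 3-colouring in the order of the numbering fail within the first 25 vertices.
joins : (s h j t i k : ℕ) → Bool
joins 0 h j 0 i k = (h ≡ᵇ i) ∧ ((j + 1) % 5 ≡ᵇ k)
joins 1 h j 1 i k = (h ≡ᵇ i) ∧ ((j + 2) % 5 ≡ᵇ k)
joins 0 h j 1 i k = (h * i + j) % 5 ≡ᵇ k
joins _ _ _ _ _ _ = false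

joined : (u v : Fin 50) → Bool
joined u v = joins (kind u) (pentagon u) (position u) (kind v) (pentagon v) (position v)

_~_ : Rel (Fin 50) 0ℓ
u ~ v = T (joined u v ∨ joined v u)

_~?_ : Decidable _~_
u ~? v = T? _

hoffmanSingleton : Graph
hoffmanSingleton = record
  { order  = 50
  ; Adj    = _~_
  ; symm   = λ {u} {v} → subst T (∨-comm (joined u v) (joined v u))
  ; irrefl = λ { {v} refl → from-yes (all? λ v → ¬? (v ~? v)) v }
  ; adj?   = _~?_
  }

diameter≤2 : HasDiameter≤2 hoffmanSingleton
diameter≤2 = from-yes (all? λ u → all? λ v →
  (u ≟ v) ⊎-dec (u ~? v) ⊎-dec any? λ w → (u ~? w) ×-dec (w ~? v))

-- Each adjacency precedes the next quantifier, so that the exhaustive check only follows edges.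
triangle-free : ∀ a b → a ~ b → ∀ c → b ~ c → ¬ c ~ a
triangle-free = from-yes (all? λ a → all? λ b → (a ~? b) →-dec
  all? λ c → (b ~? c) →-dec ¬? (c ~? a))

square-free : ∀ a b → a ~ b → ∀ c → b ~ c → a ≢ c → ∀ d → c ~ d → d ~ a → b ≡ d
square-free = from-yes (all? λ a → all? λ b → (a ~? b) →-dec
  all? λ c → (b ~? c) →-dec (¬? (a ≟ c) →-dec
  all? λ d → (c ~? d) →-dec ((d ~? a) →-dec (b ≟ d))))

girth : HasGirth hoffmanSingleton 5
girth = (pentagon₀ , (s≤s (s≤s (s≤s z≤n)) , from-yes (unique? _≟_ pentagon₀) ,
                      from-yes (linked? _~?_ (pentagon₀ ∷ʳ 0F))) , refl)
      , 5≤length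
  where
  pentagon₀ : List (Fin 50)
  pentagon₀ = 0F ∷ 1F ∷ 2F ∷ 3F ∷ 4F ∷ []

  5≤length : ∀ vs → IsCycle hoffmanSingleton vs → 5 ≤ length vs
  5≤length (_ ∷ [])     (s≤s () , _)
  5≤length (_ ∷ _ ∷ []) (s≤s (s≤s ()) , _)
  5≤length (a ∷ b ∷ c ∷ []) (_ , _ , ab ∷ bc ∷ ca ∷ _) =
    ⊥-elim (triangle-free a b ab c bc ca)
  5≤length (a ∷ b ∷ c ∷ d ∷ [])
    (_ , (_ ∷ a≢c ∷ _) ∷ (_ ∷ b≢d ∷ _) ∷ _ , ab ∷ bc ∷ cd ∷ da ∷ _) =
    ⊥-elim (b≢d (square-free a b ab c bc a≢c d cd da))
  5≤length (_ ∷ _ ∷ _ ∷ _ ∷ _ ∷ _) _ = s≤s (s≤s (s≤s (s≤s (s≤s z≤n))))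

-- Giving k, as and vs explicitly keeps Agda from solving for them by
-- unfolding the whole search tree.
not-3-colourable : ∀ f → ¬ ProperColouring hoffmanSingleton {3} f
not-3-colourable f proper =
  refuted⇒¬proper hoffmanSingleton {3} {f} proper {[]} (allFin 50) [] refuted
  where
  refuted : Refuted hoffmanSingleton 3 [] (allFin 50)
  refuted = from-yes (refuted? hoffmanSingleton 3 [] (allFin 50))

theorem17 : ∃[ G ] HasGirth G 5 × ¬ HasAOP G
theorem17 = hoffmanSingleton , girth , λ (O , acyclic , unipath) →
  not-3-colourable
    (colour hoffmanSingleton diameter≤2 O acyclic unipath)
    (colour-proper hoffmanSingleton diameter≤2 O acyclic unipath)
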